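{- Consider the self-adjusting single-source tree problem on a complete binary tree $T$ with $n$ nodes and a set $E$ of $n$ elements, in the setting described in the context. For every finite request sequence $\sigma$ and every offline algorithm $\textsc{Opt}$ that starts from the same initial placement of elements as \textsc{Rotor-Push}, the total cost of \textsc{Rotor-Push} on $\sigma$ is at most $12$ times the total cost of $\textsc{Opt}$ on $\sigma$. That is, \textsc{Rotor-Push} is $12$-competitive.
   Context: Problem: $T$ is a complete binary tree; its root $r_T$ has level $0$ and the level $\ell(v)$ of a node is its distance from the root. There is a set $E$ of $n$ elements, and at all times each node holds exactly one element ($\mathrm{nd}(e)$ is the node holding $e$, $\mathrm{el}(v)$ the element at $v$; $\ell(e)=\ell(\mathrm{nd}(e))$). Requests $\sigma=\sigma^1,\sigma^2,\dots$ are elements of $E$, revealed online. Serving a request to $e$ costs $\ell(e)+1$ (access cost); in addition, any swap of the elements at two adjacent nodes (a node and its parent) costs $1$. The total cost of an algorithm is the sum of all access costs and swap costs. The offline algorithm $\textsc{Opt}$ knows the whole sequence and may perform arbitrary swaps of adjacent elements at any time at unit cost each. Augmented push-down $\mathrm{PD}(u,v)$ for two nodes $u,v$ on the same level $d$: let $r_T=v_0,v_1,\dots,v_d=v$ be the root-to-$v$ path; consider the cycle of nodes $v_0\to v_1\to\dots\to v_d\to u\to v_0$ and move each element on a node of this cycle to the next node of the cycle (so $\mathrm{el}(u)$ goes to the root, $\mathrm{el}(v_i)$ goes to $v_{i+1}$ for $i<d$, and $\mathrm{el}(v)$ goes to $u$; if $u=v$ the element at $v$ goes to the root and the path elements shift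 down by one). It is implemented by adjacent swaps as follows: if $u=v$, the element at $v$ is swapped up to the root; otherwise the element $\mathrm{el}(v)$ is swapped up along the path to the root, then swapped down along the root-to-$u$ path to $u$, and finally the element originally at $u$ (now at the parent of $u$) is swapped up to the root. The algorithm's cost for a request is its access cost plus the number of these swaps. \textsc{Rotor-Push}: each non-leaf node has a rotor pointer to one of its children, initially the left child. The global path $P$ is the root-to-leaf path obtained by starting at $r_T$ and following pointers; $P_d$ denotes its node at level $d$. The operation $\mathrm{flip}(d)$ toggles the pointers of all nodes $P_{d'}$ with $d'<d$. Upon a request to element $e^*$ at level $d^*$, \textsc{Rotor-Push} sets $v=P_{d^*}$ (possibly $v=\mathrm{nd}(e^*)$), executes $\mathrm{PD}(\mathrm{nd}(e^*),v)$, and then executes $\mathrm{flip}(d^*)$. -}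

module Defs where

open import Data.Bool using (Bool; true; false; not; if_then_else_)
open import Data.Bool.Properties using () renaming (_≟_ to _≟B_)
open import Data.List using (List; []; _∷_; length; reverse; _++_; zip)
open import Data.List.Properties using (≡-dec)
open import Data.Nat using (ℕ; zero; suc; _+_; _*_; _≤_)
open import Data.Product using (_×_; _,_; ∃)
open import Relation.Nullary using (does)
open import Relation.Binary.PropositionalEquality using (_≡_)

-- A node of the (infinite) binary tree is addressed by its path from the
-- root, stored BOTTOM-UP: the head is the last step taken (false = left
-- child, true = right child).  Hence the parent of (b ∷ p) is p, the root
-- is [], and the level of a node is the length of its address.
Node : Set
Node = List Bool

_≟N_ : (u v : Node) → _
_≟N_ = ≡-dec _≟B_

level : Node → ℕ
level = length

-- The complete binary tree T of depth D (n = 2^(D+1) - 1 nodes) consists of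
-- the nodes of level ≤ D.
InTree : ℕ → Node → Set
InTree D v = level v ≤ D

IsPlacement : (D : ℕ) {E : Set} → (E → Node) → Set
IsPlacement D {E} nd =
  (∀ e → InTree D (nd e)) ×
  (∀ e e' → nd e ≡ nd e' → e ≡ e') ×
  (∀ v → InTree D v → ∃ λ e → nd e ≡ v)

-- A swap is named by its lower node w; it exchanges the elements at w and
-- at the parent of w.  A valid swap in T: w is a non-root node of T.
ValidSwap : ℕ → Node → Set
ValidSwap D w = 1 ≤ level w × level w ≤ D

transpose : Node → Node → Node
transpose [] v = v
transpose (b ∷ p) v =
  if does (v ≟N (b ∷ p)) then p else (if does (v ≟N p) then b ∷ p else v)

applySwap : {E : Set} → Node → (E → Node) → (E → Node)
applySwap w nd e = transpose w (nd e)

applySwaps : {E : Set} → List Node → (E → Node) → (E → Node)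
applySwaps []       nd = nd
applySwaps (w ∷ ws) nd = applySwaps ws (applySwap w nd)

upPath : Node → List Node
upPath []      = []
upPath (b ∷ p) = (b ∷ p) ∷ upPath p

parent : Node → Node
parent []      = []
parent (_ ∷ p) = p

pdSwaps : Node → Node → List Node
pdSwaps u v =
  if does (u ≟N v) then upPath v
  else upPath v ++ (reverse (upPath u) ++ upPath (parent u))

-- rotor pointers: false = left child, true = right child
Rotor : Set
Rotor = Node → Bool

initRotor : Rotor
initRotor _ = false

globalPath : Rotor → ℕ → Node
globalPath rot zero    = []
globalPath rot (suc d) = rot (globalPath rot d) ∷ globalPath rot d

toggle : Rotor → Node → Rotor
toggle rot v w = if does (w ≟N v) then not (rot w) else rot w

flipFrom : Rotor → Node → ℕ → Rotor
flipFrom rot v zero    = rot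
flipFrom rot v (suc k) = flipFrom (toggle rot v) (rot v ∷ v) k

flip : Rotor → ℕ → Rotor
flip rot d = flipFrom rot [] d

rpCost : {E : Set} → Rotor → (E → Node) → List E → ℕ
rpCost rot nd []      = 0
rpCost rot nd (e ∷ σ) =
  suc (level (nd e)) + length sw
    + rpCost (flip rot (level (nd e))) (applySwaps sw nd) σ
  where
  sw : List Node
  sw = pdSwaps (nd e) (globalPath rot (level (nd e)))

-- Offline algorithms: before serving each request, an arbitrary list of
-- adjacent swaps is performed (swaps after the last request only add cost).

optCost : {E : Set} → (E → Node) → List (List Node × E) → ℕ
optCost nd []               = 0
optCost nd ((sw , e) ∷ rest) =
  length sw + suc (level (applySwaps sw nd e)) + optCost (applySwaps sw nd) rest

{-# OPTIONS --safe #-}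
-- Attach to a node v at level ℓ of the rotor tree the number ℓ + (c + 1) / 2^ℓ,
-- where the binary digits of c (root first, least significant) say which
-- rotors above v point towards v; it is ℓ + 1 on the global path.  A request
-- raises this number by at most 2^-ℓ′ for every element not requested, ℓ′ being
-- its new level: an element pushed down from the global path moves one level
-- down, but the flip resets its c to 0.  The potential is 4 times the sum over
-- the elements of the excess of this number over 2 j + 1, where j is the level
-- of the element in the offline tree.  Only elements with ℓ′ > 2 j can
-- gain, so the total gain per request is at most the sum of 2^j * 2^-(2 j + 1)
-- over j, which is below 1.  The requested element, at level d here and k
-- offline, loses at least d - 2 k - 1, which pays for its cost of at most
-- 4 d + 1 up to 8 k + 5.  A swap of the offline algorithm raises the potential
-- by at most 8.
module Submission where

open import Defs
open import Data.Bool using (Bool; true; false; not; if_then_else_)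
open import Data.Bool.Properties using (not-¬; ¬-not) renaming (_≟_ to _≟B_)
open import Data.List using (List; []; _∷_; _++_; length; map; zip; reverse; foldl; deduplicate)
open import Data.List.Properties
  using (foldl-++; length-++; length-reverse; unfold-reverse)
open import Data.List.Membership.Propositional using (_∈_)
open import Data.List.Membership.Propositional.Properties
  using (∈-∃++; ∈-map⁺; ∈-map⁻; ∈-++⁺ˡ; ∈-++⁺ʳ; ∈-deduplicate⁺)
open import Data.List.Relation.Binary.Permutation.Propositional using (↭-sym)
open import Data.List.Relation.Binary.Permutation.Propositional.Properties
  using (∈-resp-↭; All-resp-↭; ↭-reverse; map⁺; shift)
open import Data.List.Relation.Unary.All as All using (All; []; _∷_)
import Data.List.Relation.Unary.All.Properties as All
open import Data.List.Relation.Unary.AllPairs using ([]; _∷_)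
open import Data.List.Relation.Unary.Any using (here; there)
open import Data.List.Relation.Unary.Unique.Propositional using (Unique)
import Data.List.Relation.Unary.Unique.Propositional.Properties as Unique
open import Data.List.Relation.Unary.Unique.DecPropositional.Properties using (deduplicate-!)
open import Data.Nat using (ℕ; zero; suc; _+_; _*_; _∸_; _^_; _≤_; _<_; z≤n; s≤s; _≤?_; _<?_)
open import Data.Nat.ListAction using (sum)
open import Data.Nat.ListAction.Properties using (sum-↭)
open import Data.Nat.Properties
open import Data.Nat.Tactic.RingSolver using (solve-∀)
open import Data.Product using (_×_; _,_; ∃; proj₁; proj₂)
open import Data.Sum using (_⊎_; inj₁; inj₂)
open import Function using (_∘_)
open import Relation.Binary.Definitions using (DecidableEquality; tri<; tri≈; tri>)
open import Relation.Binary.PropositionalEquality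
  using (_≡_; _≢_; refl; sym; trans; cong; cong₂; subst; subst₂)
open import Relation.Nullary using (¬_; Dec; yes; no; does; contradiction)
open import Relation.Nullary.Decidable using (map′; dec-true; dec-false)

-- Swaps

∷≢ : ∀ {b : Bool} {p : Node} → b ∷ p ≢ p
∷≢ {b} {p} eq = 1+n≢n (cong length eq)

transpose-lower : ∀ b p → transpose (b ∷ p) (b ∷ p) ≡ p
transpose-lower b p rewrite dec-true ((b ∷ p) ≟N (b ∷ p)) refl = refl

transpose-upper : ∀ b p → transpose (b ∷ p) p ≡ b ∷ p
transpose-upper b p
  rewrite dec-false (p ≟N (b ∷ p)) (∷≢ ∘ sym) | dec-true (p ≟N p) refl = refl

transpose-other : ∀ {b p x} → x ≢ b ∷ p → x ≢ p → transpose (b ∷ p) x ≡ x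
transpose-other {b} {p} {x} ≢w ≢p
  rewrite dec-false (x ≟N (b ∷ p)) ≢w | dec-false (x ≟N p) ≢p = refl

data TransposeView (b : Bool) (p : Node) : Node → Set where
  lower : TransposeView b p (b ∷ p)
  upper : TransposeView b p p
  other : ∀ {x} → x ≢ b ∷ p → x ≢ p → TransposeView b p x

transposeView : ∀ b p x → TransposeView b p x
transposeView b p x with x ≟N (b ∷ p) | x ≟N p
... | yes refl | _        = lower
... | no _     | yes refl = upper
... | no ≢w    | no ≢p    = other ≢w ≢p

transpose-involutive : ∀ w x → transpose w (transpose w x) ≡ x
transpose-involutive [] x = refl
transpose-involutive (b ∷ p) x with transposeView b p x
... | lower = trans (cong (transpose (b ∷ p)) (transpose-lower b p)) (transpose-upper b p)
... | upper = trans (cong (transpose (b ∷ p)) (transpose-upper b p)) (transpose-lower b p)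
... | other ≢w ≢p =
  trans (cong (transpose (b ∷ p)) (transpose-other ≢w ≢p)) (transpose-other ≢w ≢p)

transpose-injective : ∀ w {x y} → transpose w x ≡ transpose w y → x ≡ y
transpose-injective w {x} {y} eq =
  trans (sym (transpose-involutive w x))
    (trans (cong (transpose w) eq) (transpose-involutive w y))

transpose-InTree : ∀ {D w} → level w ≤ D → ∀ {x} → InTree D x → InTree D (transpose w x)
transpose-InTree {w = []} _ x∈ = x∈
transpose-InTree {D} {b ∷ p} w∈ {x} x∈ with transposeView b p x
... | lower rewrite transpose-lower b p = ≤-trans (n≤1+n _) w∈
... | upper rewrite transpose-upper b p = w∈
... | other ≢w ≢p rewrite transpose-other ≢w ≢p = x∈

move : List Node → Node → Node
move ws x = foldl (λ y w → transpose w y) x ws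

move-++ : ∀ ws ws′ x → move (ws ++ ws′) x ≡ move ws′ (move ws x)
move-++ ws ws′ x = foldl-++ _ x ws ws′

applySwaps-move : ∀ {E : Set} ws (nd : E → Node) e → applySwaps ws nd e ≡ move ws (nd e)
applySwaps-move []       nd e = refl
applySwaps-move (w ∷ ws) nd e = applySwaps-move ws (applySwap w nd) e

-- Each swap is an involution, so the reversed list is the inverse permutation. This turns the
-- downward walk into the inverse of the upward one.
move-reverse : ∀ ws x → move ws (move (reverse ws) x) ≡ x
move-reverse [] x = refl
move-reverse (w ∷ ws) x
  rewrite unfold-reverse w ws | move-++ (reverse ws) (w ∷ []) x
        | transpose-involutive w (move (reverse ws) x) = move-reverse ws x

move-injective : ∀ ws {x y} → move ws x ≡ move ws y → x ≡ y
move-injective []       eq = eq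
move-injective (w ∷ ws) eq = transpose-injective w (move-injective ws eq)

move-InTree : ∀ {D ws} → All (ValidSwap D) ws → ∀ {x} → InTree D x → InTree D (move ws x)
move-InTree []                     x∈ = x∈
move-InTree {ws = w ∷ _} ((_ , w∈) ∷ ws∈) {x} x∈ = move-InTree ws∈ (transpose-InTree {w = w} w∈ {x} x∈)

-- Walks along a path to the root.

upPath-valid : ∀ {D} v → InTree D v → All (ValidSwap D) (upPath v)
upPath-valid []      _  = []
upPath-valid (b ∷ p) v∈ = (s≤s z≤n , v∈) ∷ upPath-valid p (≤-trans (n≤1+n _) v∈)

move-upPath-end : ∀ v → move (upPath v) v ≡ []
move-upPath-end []      = refl
move-upPath-end (b ∷ p) rewrite transpose-lower b p = move-upPath-end p

move-upPath-deep : ∀ v {x} → level v < level x → move (upPath v) x ≡ x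
move-upPath-deep [] _ = refl
move-upPath-deep (b ∷ p) {x} lt
  rewrite transpose-other {b} {p} {x} (λ { refl → <-irrefl refl lt })
                                      (λ { refl → <-asym lt (n<1+n _) })
  = move-upPath-deep p (<-trans (n<1+n _) lt)

-- The down-and-up walk is the conjugate by `move (upPath q)` of the swap at
-- `c ∷ q`, hence the transposition of `c ∷ q` with the root.
move-downUp : ∀ c q x → move (reverse (upPath (c ∷ q)) ++ upPath q) x ≡
  move (upPath q) (transpose (c ∷ q) (move (reverse (upPath q)) x))
move-downUp c q x
  rewrite move-++ (reverse (upPath (c ∷ q))) (upPath q) x
        | unfold-reverse (c ∷ q) (upPath q)
        | move-++ (reverse (upPath q)) ((c ∷ q) ∷ []) x = refl

move-reverse-upPath-[] : ∀ q → move (reverse (upPath q)) [] ≡ q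
move-reverse-upPath-[] q = move-injective (upPath q)
  (trans (move-reverse (upPath q) []) (sym (move-upPath-end q)))

move-reverse-upPath-deep : ∀ q {x} → level q < level x → move (reverse (upPath q)) x ≡ x
move-reverse-upPath-deep q {x} lt = move-injective (upPath q)
  (trans (move-reverse (upPath q) x) (sym (move-upPath-deep q lt)))

move-downUp-[] : ∀ c q → move (reverse (upPath (c ∷ q)) ++ upPath q) [] ≡ c ∷ q
move-downUp-[] c q
  rewrite move-downUp c q [] | move-reverse-upPath-[] q | transpose-upper c q
  = move-upPath-deep q (n<1+n _)

move-downUp-end : ∀ c q → move (reverse (upPath (c ∷ q)) ++ upPath q) (c ∷ q) ≡ []
move-downUp-end c q
  rewrite move-downUp c q (c ∷ q) | move-reverse-upPath-deep q {c ∷ q} (n<1+n _)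
        | transpose-lower c q
  = move-upPath-end q

move-downUp-other : ∀ c q {x} → x ≢ [] → x ≢ c ∷ q →
  move (reverse (upPath (c ∷ q)) ++ upPath q) x ≡ x
move-downUp-other c q {x} ≢[] ≢u
  rewrite move-downUp c q x
        | transpose-other {c} {q} {move (reverse (upPath q)) x}
            (λ eq → ≢u (trans (sym (move-reverse (upPath q) x))
                          (trans (cong (move (upPath q)) eq) (move-upPath-deep q (n<1+n _)))))
            (λ eq → ≢[] (trans (sym (move-reverse (upPath q) x))
                          (trans (cong (move (upPath q)) eq) (move-upPath-end q))))
  = move-reverse (upPath q) x

-- The global path and the push-down operation

level-globalPath : ∀ rot d → level (globalPath rot d) ≡ d
level-globalPath rot zero    = refl
level-globalPath rot (suc d) = cong suc (level-globalPath rot d)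

level-globalPath-< : ∀ rot {i d} → i < d → level (globalPath rot i) < level (globalPath rot d)
level-globalPath-< rot {i} {d} =
  subst₂ _<_ (sym (level-globalPath rot i)) (sym (level-globalPath rot d))

OnPath : Rotor → Node → Set
OnPath rot x = x ≡ globalPath rot (level x)

globalPath-OnPath : ∀ rot d → OnPath rot (globalPath rot d)
globalPath-OnPath rot d = cong (globalPath rot) (sym (level-globalPath rot d))

≡globalPath⇒OnPath : ∀ rot d {x} → x ≡ globalPath rot d → OnPath rot x
≡globalPath⇒OnPath rot d refl = globalPath-OnPath rot d

≢-level : ∀ {x y : Node} → level x < level y → x ≢ y
≢-level lt refl = <-irrefl refl lt

-- The swaps run from the bottom upwards. The first one to touch level `i` carries the element there
-- one level down, and all later ones act strictly above its new place.
move-globalPath-on : ∀ rot d {i} → i < d →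
  move (upPath (globalPath rot d)) (globalPath rot i) ≡ globalPath rot (suc i)
move-globalPath-on rot (suc d) {i} (s≤s i≤d) with m≤n⇒m<n∨m≡n i≤d
... | inj₂ refl rewrite transpose-upper (rot (globalPath rot d)) (globalPath rot d) =
  move-upPath-deep (globalPath rot d) (n<1+n _)
... | inj₁ i<d
  rewrite transpose-other {rot (globalPath rot d)} {globalPath rot d} {globalPath rot i}
            (≢-level (<-trans (level-globalPath-< rot i<d) (n<1+n _)))
            (≢-level (level-globalPath-< rot i<d))
  = move-globalPath-on rot d i<d

move-globalPath-off : ∀ rot d {x} → ¬ OnPath rot x → move (upPath (globalPath rot d)) x ≡ x
move-globalPath-off rot zero _ = refl
move-globalPath-off rot (suc d) {x} off
  rewrite transpose-other {rot (globalPath rot d)} {globalPath rot d} {x}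
            (off ∘ ≡globalPath⇒OnPath rot (suc d)) (off ∘ ≡globalPath⇒OnPath rot d)
  = move-globalPath-off rot d off

-- The fate of an element at `x` other than the requested one at `u`. The case `stay` joins nodes
-- off the path with path nodes deeper than `u`, in the form that `corank-flip` takes as its
-- hypothesis.
data PushDown (rot : Rotor) (u x y : Node) : Set where
  stay   : (OnPath rot x → level u < level x) → y ≡ x → PushDown rot u x y
  down   : OnPath rot x → level x < level u → y ≡ globalPath rot (suc (level x)) →
           PushDown rot u x y
  across : OnPath rot x → level x ≡ level u → y ≡ u → PushDown rot u x y

OnPath? : ∀ rot x → Dec (OnPath rot x)
OnPath? rot x = x ≟N globalPath rot (level x)

pd : Rotor → Node → List Node
pd rot u = pdSwaps u (globalPath rot (level u))


-- The first walk of the push-down. The path node on the level of `u` is excluded since this walk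
-- carries its element to the root.
move-upPath-globalPath : ∀ rot u {x} → ¬ (OnPath rot x × level x ≡ level u) →
  PushDown rot u x (move (upPath (globalPath rot (level u))) x)
move-upPath-globalPath rot u {x} ¬end with OnPath? rot x
... | no off = stay (λ on → contradiction on off) (move-globalPath-off rot (level u) off)
... | yes on with <-cmp (level x) (level u)
... | tri≈ _ eq _ = contradiction (on , eq) ¬end
... | tri< lt _ _ = down on lt
  (trans (cong (move (upPath (globalPath rot (level u)))) on) (move-globalPath-on rot (level u) lt))
... | tri> _ _ gt = stay (λ _ → gt) (move-upPath-deep (globalPath rot (level u))
  (subst (_< level x) (sym (level-globalPath rot (level u))) gt))

move-pd-end : ∀ rot u → move (pd rot u) u ≡ []
move-pd-end rot u with OnPath? rot u
move-pd-end rot u | yes on =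
  trans (cong (λ v → move (upPath v) u) (sym on)) (move-upPath-end u)
move-pd-end rot [] | no off = contradiction refl off
move-pd-end rot u@(c ∷ q) | no off
  rewrite move-++ (upPath (globalPath rot (level u))) (reverse (upPath u) ++ upPath q) u
        | move-globalPath-off rot (level u) off
  = move-downUp-end c q

-- The remaining two walks only exchange the root with `c ∷ q`. After the first walk neither place
-- holds an element considered here: pushed elements are below the root and on the path, whereas
-- `c ∷ q` is off it.
pushDown-downUp : ∀ {rot c q x y} → ¬ OnPath rot (c ∷ q) → x ≢ c ∷ q →
  ¬ (OnPath rot x × level x ≡ level (c ∷ q)) →
  PushDown rot (c ∷ q) x y →
  PushDown rot (c ∷ q) x (move (reverse (upPath (c ∷ q)) ++ upPath q) y)
pushDown-downUp {rot} {c} {q} {x} off x≢u _ (stay deep refl) =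
  stay deep (move-downUp-other c q {x} (λ { refl → contradiction (deep refl) λ () }) x≢u)
pushDown-downUp {rot} {c} {q} {x} off x≢u _ (down on lt refl) = down on lt
  (move-downUp-other c q (λ ()) (off ∘ ≡globalPath⇒OnPath rot (suc (level x)) ∘ sym))
pushDown-downUp off x≢u ¬end (across on eq _) = contradiction (on , eq) ¬end

move-pd : ∀ rot u {x} → x ≢ u → PushDown rot u x (move (pd rot u) x)
move-pd rot u {x} x≢u with OnPath? rot u
move-pd rot u {x} x≢u | yes on = move-upPath-globalPath rot u
  λ (onx , eq) → x≢u (trans onx (trans (cong (globalPath rot) eq) (sym on)))
move-pd rot [] x≢u | no off = contradiction refl off
move-pd rot u@(c ∷ q) {x} x≢u | no off
  rewrite move-++ (upPath (globalPath rot (level u))) (reverse (upPath u) ++ upPath q) x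
  with OnPath? rot x | level x ≟ level u
-- The element at the end of the path reaches the root in the first walk, and the exchange then
-- sends it to `u`.
... | yes on | yes eq = across on eq
  (trans (cong (move (reverse (upPath u) ++ upPath q)) to-root) (move-downUp-[] c q))
  where
  to-root : move (upPath (globalPath rot (level u))) x ≡ []
  to-root = trans
    (cong (λ v → move (upPath v) x) (trans (cong (globalPath rot) (sym eq)) (sym on)))
    (move-upPath-end x)
... | no offx | _ = pushDown-downUp off x≢u (offx ∘ proj₁)
  (move-upPath-globalPath rot u (offx ∘ proj₁))
... | yes _ | no neq = pushDown-downUp off x≢u (neq ∘ proj₂)
  (move-upPath-globalPath rot u (neq ∘ proj₂))

-- Cost and validity of the push-down.

length-upPath : ∀ v → length (upPath v) ≡ level v
length-upPath []      = refl
length-upPath (b ∷ p) = cong suc (length-upPath p)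

-- With `d = level u`, the three walks take `d`, `d` and `d - 1` swaps when `u` is off the path, and
-- a single walk of `d` swaps suffices otherwise.
length-pd : ∀ rot u → length (pd rot u) ≤ 3 * level u
length-pd rot u with OnPath? rot u
... | yes _ rewrite length-upPath (globalPath rot (level u)) | level-globalPath rot (level u) =
  m≤m+n (level u) _
... | no _
  rewrite length-++ (upPath (globalPath rot (level u))) {reverse (upPath u) ++ upPath (parent u)}
        | length-++ (reverse (upPath u)) {upPath (parent u)}
        | length-reverse (upPath u) | length-upPath u
        | length-upPath (globalPath rot (level u)) | level-globalPath rot (level u)
        | length-upPath (parent u)
  = +-monoʳ-≤ (level u) (+-monoʳ-≤ (level u) (≤-trans (level-parent u) (m≤m+n (level u) 0)))
  where
  level-parent : ∀ v → level (parent v) ≤ level v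
  level-parent []      = z≤n
  level-parent (b ∷ p) = n≤1+n _

pd-valid : ∀ {D} rot u → InTree D u → All (ValidSwap D) (pd rot u)
pd-valid {D} rot u u∈ with OnPath? rot u
... | yes _ = upPath-valid (globalPath rot (level u)) target∈
  where
  target∈ : InTree D (globalPath rot (level u))
  target∈ = subst (_≤ D) (sym (level-globalPath rot (level u))) u∈
... | no _ = All.++⁺ (upPath-valid (globalPath rot (level u)) target∈)
  (All.++⁺ (All-resp-↭ (↭-sym (↭-reverse _)) (upPath-valid u u∈))
    (upPath-valid (parent u) (parent∈ u u∈)))
  where
  target∈ : InTree D (globalPath rot (level u))
  target∈ = subst (_≤ D) (sym (level-globalPath rot (level u))) u∈
  parent∈ : ∀ v → InTree D v → InTree D (parent v)
  parent∈ []      v∈ = v∈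
  parent∈ (b ∷ p) v∈ = ≤-trans (n≤1+n _) v∈

-- Flips

toggle-here : ∀ rot v → toggle rot v v ≡ not (rot v)
toggle-here rot v rewrite dec-true (v ≟N v) refl = refl

toggle-other : ∀ rot {v w} → w ≢ v → toggle rot v w ≡ rot w
toggle-other rot {v} {w} w≢v rewrite dec-false (w ≟N v) w≢v = refl

-- Toggling proceeds downwards, so the pointers still to be read have their original values. Hence
-- `flipFrom` follows the old path although it consults the updated rotor.
toggled-agree : ∀ ρ rot i → (∀ x → i ≤ level x → rot x ≡ ρ x) →
  ∀ x → suc i ≤ level x → toggle rot (globalPath ρ i) x ≡ ρ x
toggled-agree ρ rot i agree x i<x = trans
  (toggle-other rot λ { refl → <-irrefl (sym (level-globalPath ρ i)) i<x })
  (agree x (<⇒≤ i<x))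

-- Here `ρ` is the rotor before the flip, `rot` its state once the flip has
-- toggled the first `i` nodes of the path.
flipFrom-fixed : ∀ ρ rot i k {w} → (∀ x → i ≤ level x → rot x ≡ ρ x) →
  (OnPath ρ w → level w < i ⊎ i + k ≤ level w) →
  flipFrom rot (globalPath ρ i) k w ≡ rot w
flipFrom-fixed ρ rot i zero agree away = refl
flipFrom-fixed ρ rot i (suc k) {w} agree away
  rewrite agree (globalPath ρ i) (≤-reflexive (sym (level-globalPath ρ i)))
  = trans (flipFrom-fixed ρ (toggle rot (globalPath ρ i)) (suc i) k
             (toggled-agree ρ rot i agree) away′)
          (toggle-other rot w≢)
  where
  away′ : OnPath ρ w → level w < suc i ⊎ suc i + k ≤ level w
  away′ on with away on
  ... | inj₁ lt = inj₁ (m≤n⇒m≤1+n lt)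
  ... | inj₂ le = inj₂ (subst (_≤ level w) (+-suc i k) le)
  w≢ : w ≢ globalPath ρ i
  w≢ refl with away (globalPath-OnPath ρ i)
  ... | inj₁ lt = <-irrefl (level-globalPath ρ i) lt
  ... | inj₂ le = m+1+n≰m i (subst (i + suc k ≤_) (level-globalPath ρ i) le)

-- Each path node is toggled exactly once: earlier toggles lie strictly above level `j` and later
-- ones strictly below.
flipFrom-toggled : ∀ ρ rot i k {j} → (∀ x → i ≤ level x → rot x ≡ ρ x) → i ≤ j → j < i + k →
  flipFrom rot (globalPath ρ i) k (globalPath ρ j) ≡ not (ρ (globalPath ρ j))
flipFrom-toggled ρ rot i zero {j} agree i≤j j<
  = contradiction (subst (j <_) (+-identityʳ i) j<) (≤⇒≯ i≤j)
flipFrom-toggled ρ rot i (suc k) {j} agree i≤j j<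
  rewrite agree (globalPath ρ i) (≤-reflexive (sym (level-globalPath ρ i)))
  with m≤n⇒m<n∨m≡n i≤j
... | inj₁ i<j = flipFrom-toggled ρ (toggle rot (globalPath ρ i)) (suc i) k
  (toggled-agree ρ rot i agree) i<j (subst (j <_) (+-suc i k) j<)
... | inj₂ refl = trans
  (flipFrom-fixed ρ (toggle rot (globalPath ρ i)) (suc i) k (toggled-agree ρ rot i agree)
    λ _ → inj₁ (s≤s (≤-reflexive (level-globalPath ρ i))))
  (trans (toggle-here rot (globalPath ρ i))
    (cong not (agree _ (≤-reflexive (sym (level-globalPath ρ i))))))

flip-fixed : ∀ rot d {w} → (OnPath rot w → d ≤ level w) → flip rot d w ≡ rot w
flip-fixed rot d away = flipFrom-fixed rot rot 0 d (λ _ _ → refl) (inj₂ ∘ away)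

flip-toggled : ∀ rot {d w} → OnPath rot w → level w < d → flip rot d w ≡ not (rot w)
flip-toggled rot {d} {w} on lt =
  subst (λ v → flip rot d v ≡ not (rot v)) (sym on)
    (flipFrom-toggled rot rot 0 d (λ _ _ → refl) z≤n lt)

-- Flip-ranks.  `2 ^ level v ∸ corank rot v` is one more than the number of
-- flips of depth `level v` after which `v` lies on the global path.

agreement : Bool → Bool → ℕ
agreement b c = if does (b ≟B c) then 1 else 0

corank : Rotor → Node → ℕ
corank rot []      = 0
corank rot (b ∷ p) = corank rot p + agreement (rot p) b * 2 ^ level p

corank-bound : ∀ rot v → suc (corank rot v) ≤ 2 ^ level v
corank-bound rot [] = ≤-refl
corank-bound rot (b ∷ p) =
  +-mono-≤ (corank-bound rot p) (*-monoˡ-≤ (2 ^ level p) (agreement≤1 (rot p) b))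
  where
  agreement≤1 : ∀ b c → agreement b c ≤ 1
  agreement≤1 b c with does (b ≟B c)
  ... | true  = ≤-refl
  ... | false = z≤n

agreement-refl : ∀ b → agreement b b ≡ 1
agreement-refl b rewrite dec-true (b ≟B b) refl = refl

agreement-≢ : ∀ {b c} → b ≢ c → agreement b c ≡ 0
agreement-≢ {b} {c} b≢c rewrite dec-false (b ≟B c) b≢c = refl

corank-globalPath : ∀ rot d → suc (corank rot (globalPath rot d)) ≡ 2 ^ d
corank-globalPath rot zero = refl
corank-globalPath rot (suc d)
  rewrite agreement-refl (rot (globalPath rot d)) | level-globalPath rot d
  = cong (_+ (2 ^ d + 0)) (corank-globalPath rot d)

-- On the old path every digit is 1, and the flip reverses each pointer that these digits compare
-- with.
corank-flip-globalPath : ∀ rot {d} i → i ≤ d → corank (flip rot d) (globalPath rot i) ≡ 0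
corank-flip-globalPath rot zero _ = refl
corank-flip-globalPath rot {d} (suc i) i<d
  rewrite corank-flip-globalPath rot {d} i (<⇒≤ i<d)
        | flip-toggled rot {d} (globalPath-OnPath rot i)
            (subst (_< d) (sym (level-globalPath rot i)) i<d)
        | agreement-≢ {not (rot (globalPath rot i))} {rot (globalPath rot i)}
            (λ eq → not-¬ refl (sym eq))
  = refl

-- A binary counter: the digits of `x` are 1 until it leaves the path, where the digit is 0. A flip
-- reaching that digit turns these into 0 and 1, an increment with carry; a shorter flip only clears
-- digits equal to 1. Pointers off the path do not change.
corank-flip : ∀ rot d x → (OnPath rot x → d < level x) →
  corank (flip rot d) x ≤ suc (corank rot x)
corank-flip rot d [] _ = z≤n
corank-flip rot d (b ∷ p) away with OnPath? rot p | level p <? d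
-- Here `x` leaves the path at `p`, and the carry arrives at this digit.
... | yes on | yes lt = begin
  corank (flip rot d) p + agreement (flip rot d p) b * 2 ^ level p
    ≡⟨ cong₂ (λ c a → c + a * 2 ^ level p) flipped-corank
         (trans (cong (λ c → agreement c b) (trans (flip-toggled rot on lt) (sym (¬-not b≢))))
           (agreement-refl b)) ⟩
  2 ^ level p + 0         ≡⟨ +-identityʳ _ ⟩
  2 ^ level p             ≡⟨ corank-globalPath rot (level p) ⟨
  suc (corank rot (globalPath rot (level p))) ≡⟨ cong (suc ∘ corank rot) on ⟨
  suc (corank rot p)      ≤⟨ s≤s (m≤m+n _ _) ⟩
  suc (corank rot p + agreement (rot p) b * 2 ^ level p) ∎
  where
  open ≤-Reasoning
  flipped-corank : corank (flip rot d) p ≡ 0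
  flipped-corank = trans (cong (corank (flip rot d)) on) (corank-flip-globalPath rot (level p) (<⇒≤ lt))
  b≢ : b ≢ rot p
  b≢ eq = contradiction (away (cong₂ _∷_ (trans eq (cong rot on)) on)) (≤⇒≯ lt)
... | yes on | no ≮ rewrite flip-fixed rot d {p} (λ _ → ≮⇒≥ ≮) = +-monoˡ-≤ _ bound
  where
  bound : corank (flip rot d) p ≤ suc (corank rot p)
  bound with m≤n⇒m<n∨m≡n (≮⇒≥ ≮)
  ... | inj₁ d<p  = corank-flip rot d p (λ _ → d<p)
  ... | inj₂ refl = subst (_≤ suc (corank rot p)) (sym (trans (cong (corank (flip rot d)) on)
                      (corank-flip-globalPath rot (level p) ≤-refl))) z≤n
... | no off | _ rewrite flip-fixed rot d {p} (λ on → contradiction on off) =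
  +-monoˡ-≤ _ (corank-flip rot d p (λ on → contradiction on off))

-- Since `suc (corank rot v) / 2 ^ level v` lies in (0 , 1], the height of `v`
-- is `2 ^ M` times a number in (level v , level v + 1].
height : ℕ → Rotor → Node → ℕ
height M rot v = level v * 2 ^ M + suc (corank rot v) * 2 ^ (M ∸ level v)

2^m*2^[M∸m]≡2^M : ∀ {M m} → m ≤ M → 2 ^ m * 2 ^ (M ∸ m) ≡ 2 ^ M
2^m*2^[M∸m]≡2^M {M} {m} m≤M =
  trans (sym (^-distribˡ-+-* 2 m (M ∸ m))) (cong (2 ^_) (m+[n∸m]≡n m≤M))

height≤ : ∀ {M} rot v → level v ≤ M → height M rot v ≤ suc (level v) * 2 ^ M
height≤ {M} rot v v≤M = begin
  level v * 2 ^ M + suc (corank rot v) * 2 ^ (M ∸ level v)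
    ≤⟨ +-monoʳ-≤ (level v * 2 ^ M) (*-monoˡ-≤ (2 ^ (M ∸ level v)) (corank-bound rot v)) ⟩
  level v * 2 ^ M + 2 ^ level v * 2 ^ (M ∸ level v)
    ≡⟨ cong (level v * 2 ^ M +_) (2^m*2^[M∸m]≡2^M v≤M) ⟩
  level v * 2 ^ M + 2 ^ M ≡⟨ +-comm (level v * 2 ^ M) (2 ^ M) ⟩
  suc (level v) * 2 ^ M   ∎
  where open ≤-Reasoning

height-OnPath : ∀ {M} rot {v} → level v ≤ M → OnPath rot v → height M rot v ≡ suc (level v) * 2 ^ M
height-OnPath {M} rot {v} v≤M on = trans
  (cong (level v * 2 ^ M +_) (trans (cong (_* 2 ^ (M ∸ level v)) full) (2^m*2^[M∸m]≡2^M v≤M)))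
  (+-comm (level v * 2 ^ M) (2 ^ M))
  where
  full : suc (corank rot v) ≡ 2 ^ level v
  full = trans (cong (suc ∘ corank rot) on) (corank-globalPath rot (level v))

height-flip-globalPath : ∀ M rot {d} i → i ≤ d →
  height M (flip rot d) (globalPath rot i) ≡ i * 2 ^ M + 2 ^ (M ∸ i)
height-flip-globalPath M rot {d} i i≤d
  rewrite corank-flip-globalPath rot {d} i i≤d | level-globalPath rot i
  = cong (i * 2 ^ M +_) (*-identityˡ (2 ^ (M ∸ i)))

-- A staying element gains at most one unit of corank, worth `2 ^ (M ∸ level x)`. One moving down
-- had the greatest height of its level and restarts with corank 0 on the next, so the bound is
-- attained. One moving across had the greatest height of a level that it keeps.
height-pushDown : ∀ {M} rot u {x y} → level x ≤ M → level u ≤ M → PushDown rot u x y →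
  height M (flip rot (level u)) y ≤ height M rot x + 2 ^ (M ∸ level y)
height-pushDown {M} rot u {x} x≤M u≤M (stay deep refl) = begin
  level x * 2 ^ M + suc (corank (flip rot (level u)) x) * w
    ≤⟨ +-monoʳ-≤ (level x * 2 ^ M) (*-monoˡ-≤ w (s≤s (corank-flip rot (level u) x deep))) ⟩
  level x * 2 ^ M + (w + suc (corank rot x) * w)
    ≡⟨ cong (level x * 2 ^ M +_) (+-comm w _) ⟩
  level x * 2 ^ M + (suc (corank rot x) * w + w)
    ≡⟨ +-assoc (level x * 2 ^ M) _ w ⟨
  height M rot x + w ∎
  where
  open ≤-Reasoning
  w = 2 ^ (M ∸ level x)
height-pushDown {M} rot u {x} x≤M u≤M (down on lt refl) = ≤-reflexive (trans
  (height-flip-globalPath M rot {level u} (suc (level x)) lt)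
  (cong₂ (λ h ℓ → h + 2 ^ (M ∸ ℓ))
    (sym (height-OnPath rot x≤M on)) (sym (level-globalPath rot (suc (level x))))))
height-pushDown {M} rot u {x} x≤M u≤M (across on eq refl) = begin
  height M (flip rot (level u)) u ≤⟨ height≤ (flip rot (level u)) u u≤M ⟩
  suc (level u) * 2 ^ M           ≡⟨ cong (λ d → suc d * 2 ^ M) eq ⟨
  suc (level x) * 2 ^ M           ≡⟨ height-OnPath rot x≤M on ⟨
  height M rot x                  ≤⟨ m≤m+n _ _ ⟩
  height M rot x + 2 ^ (M ∸ level u) ∎
  where open ≤-Reasoning

-- Finite sums

∑ : {A : Set} → List A → (A → ℕ) → ℕ
∑ xs f = sum (map f xs)

∑-mono : ∀ {A : Set} (xs : List A) {f g : A → ℕ} → (∀ x → f x ≤ g x) → ∑ xs f ≤ ∑ xs g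
∑-mono []       f≤g = z≤n
∑-mono (x ∷ xs) f≤g = +-mono-≤ (f≤g x) (∑-mono xs f≤g)

∑-+ : ∀ {A : Set} (xs : List A) (f g : A → ℕ) → ∑ xs (λ x → f x + g x) ≡ ∑ xs f + ∑ xs g
∑-+ []       f g = refl
∑-+ (x ∷ xs) f g rewrite ∑-+ xs f g = interchange (f x) (g x) (∑ xs f) (∑ xs g)
  where
  interchange : ∀ a b c d → (a + b) + (c + d) ≡ (a + c) + (b + d)
  interchange = solve-∀

∑-∈ : ∀ {A : Set} {xs : List A} (f : A → ℕ) {x} → x ∈ xs → f x ≤ ∑ xs f
∑-∈ f (here refl) = m≤m+n _ _
∑-∈ {xs = y ∷ _} f (there x∈) = ≤-trans (∑-∈ f x∈) (m≤n+m _ (f y))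

∑-map : ∀ {A B : Set} (h : A → B) xs (f : B → ℕ) → ∑ (map h xs) f ≡ ∑ xs (f ∘ h)
∑-map h []       f = refl
∑-map h (x ∷ xs) f = cong (f (h x) +_) (∑-map h xs f)

∑-⊆ : ∀ {A : Set} {xs ys : List A} (f : A → ℕ) → Unique xs → (∀ {x} → x ∈ xs → x ∈ ys) →
  ∑ xs f ≤ ∑ ys f
∑-⊆ f [] _ = z≤n
∑-⊆ {xs = x ∷ xs} {ys} f (x∉ ∷ xs!) xs⊆ys with ∈-∃++ (xs⊆ys (here refl))
... | as , bs , refl = begin
  f x + ∑ xs f         ≤⟨ +-monoʳ-≤ (f x) (∑-⊆ f xs! xs⊆) ⟩
  f x + ∑ (as ++ bs) f ≡⟨ sum-↭ (map⁺ f (shift x as bs)) ⟨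
  ∑ (as ++ x ∷ bs) f   ∎
  where
  open ≤-Reasoning
  xs⊆ : ∀ {y} → y ∈ xs → y ∈ as ++ bs
  xs⊆ y∈ with ∈-resp-↭ (shift x as bs) (xs⊆ys (there y∈))
  ... | here refl = contradiction refl (All.lookup x∉ y∈)
  ... | there y∈′ = y∈′

-- The nodes of the tree by level, and their total weight.

nodesAt : ℕ → List Node
nodesAt zero    = [] ∷ []
nodesAt (suc k) = map (false ∷_) (nodesAt k) ++ map (true ∷_) (nodesAt k)

nodesUpTo : ℕ → List Node
nodesUpTo zero    = nodesAt zero
nodesUpTo (suc D) = nodesAt (suc D) ++ nodesUpTo D

∈-nodesAt : ∀ v → v ∈ nodesAt (level v)
∈-nodesAt []          = here refl
∈-nodesAt (false ∷ p) = ∈-++⁺ˡ (∈-map⁺ (false ∷_) (∈-nodesAt p))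
∈-nodesAt (true ∷ p)  = ∈-++⁺ʳ _ (∈-map⁺ (true ∷_) (∈-nodesAt p))

∈-nodesUpTo : ∀ {D v} → InTree D v → v ∈ nodesUpTo D
∈-nodesUpTo {zero}  {[]} _ = here refl
∈-nodesUpTo {suc D} {v} v≤ with m≤n⇒m<n∨m≡n v≤
... | inj₁ (s≤s v≤D) = ∈-++⁺ʳ (nodesAt (suc D)) (∈-nodesUpTo v≤D)
... | inj₂ eq        = ∈-++⁺ˡ (subst (λ k → v ∈ nodesAt k) eq (∈-nodesAt v))

∑-++ : ∀ {A : Set} xs ys (f : A → ℕ) → ∑ (xs ++ ys) f ≡ ∑ xs f + ∑ ys f
∑-++ []       ys f = refl
∑-++ (x ∷ xs) ys f = trans (cong (f x +_) (∑-++ xs ys f)) (sym (+-assoc (f x) _ _))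

∑-nodesAt : ∀ k (f : ℕ → ℕ) → ∑ (nodesAt k) (f ∘ level) ≡ 2 ^ k * f k
∑-nodesAt zero    f = refl
∑-nodesAt (suc k) f
  rewrite ∑-++ (map (false ∷_) (nodesAt k)) (map (true ∷_) (nodesAt k)) (f ∘ level)
        | ∑-map (false ∷_) (nodesAt k) (f ∘ level)
        | ∑-map (true ∷_) (nodesAt k) (f ∘ level)
        | ∑-nodesAt k (f ∘ suc) = double (2 ^ k) (f (suc k))
  where
  double : ∀ a b → a * b + a * b ≡ 2 * a * b
  double = solve-∀

-- The largest growth of height, scaled by `2 ^ M`, at a level above `2 * j`.
weight : ℕ → ℕ → ℕ
weight M j = 2 ^ (M ∸ suc (2 * j))

-- Level `j` has `2 ^ j` nodes and contributes `2 ^ (M ∸ suc j)`. The extra summand is the tail of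
-- this geometric series; with it the induction telescopes.
∑-nodesUpTo-weight : ∀ {M} D → suc (2 * D) ≤ M →
  ∑ (nodesUpTo D) (weight M ∘ level) + 2 ^ (M ∸ suc D) ≤ 2 ^ M
∑-nodesUpTo-weight {suc M} zero (s≤s _) = ≤-reflexive (twice (2 ^ M))
  where
  twice : ∀ a → a + 0 + a ≡ 2 * a
  twice = solve-∀
∑-nodesUpTo-weight {M} (suc D) D≤ with m≤n⇒∃[o]m+o≡n D≤
-- The slack `t` of `M` over `2 * d + 1` expresses all exponents without truncated subtraction.
... | t , refl = begin
  ∑ (nodesAt d ++ nodesUpTo D) w + 2 ^ (M ∸ suc d)
    ≡⟨ cong (_+ 2 ^ (M ∸ suc d)) (∑-++ (nodesAt d) (nodesUpTo D) w) ⟩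
  ∑ (nodesAt d) w + ∑ (nodesUpTo D) w + 2 ^ (M ∸ suc d)
    ≡⟨ cong₂ (λ a b → a + ∑ (nodesUpTo D) w + 2 ^ b) at-d M∸1+d≡d+t ⟩
  2 ^ (d + t) + ∑ (nodesUpTo D) w + 2 ^ (d + t)
    ≡⟨ collect (2 ^ (d + t)) (∑ (nodesUpTo D) w) ⟩
  ∑ (nodesUpTo D) w + 2 ^ suc (d + t)
    ≡⟨ cong (λ a → ∑ (nodesUpTo D) w + 2 ^ a) M∸d≡1+d+t ⟨
  ∑ (nodesUpTo D) w + 2 ^ (M ∸ d)
    ≤⟨ ∑-nodesUpTo-weight D (≤-trans (s≤s (*-monoʳ-≤ 2 (n≤1+n D))) D≤) ⟩
  2 ^ M ∎
  where
  open ≤-Reasoning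
  d = suc D
  w = weight M ∘ level
  M≡ : M ≡ d + suc (d + t)
  M≡ = regroup d t
    where
    regroup : ∀ d t → suc (2 * d) + t ≡ d + suc (d + t)
    regroup = solve-∀
  M∸d≡1+d+t : M ∸ d ≡ suc (d + t)
  M∸d≡1+d+t = trans (cong (_∸ d) M≡) (m+n∸m≡n d _)
  M∸1+d≡d+t : M ∸ suc d ≡ d + t
  M∸1+d≡d+t = trans (cong (_∸ suc d) (trans M≡ (+-suc d (d + t)))) (m+n∸m≡n d _)
  at-d : ∑ (nodesAt d) w ≡ 2 ^ (d + t)
  at-d = trans (∑-nodesAt d (weight M)) (trans
    (cong (λ a → 2 ^ d * 2 ^ a) (m+n∸m≡n (suc (2 * d)) t)) (sym (^-distribˡ-+-* 2 d t)))
  collect : ∀ a b → a + b + a ≡ b + 2 * a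
  collect = solve-∀

∑-indicator : ∀ {xs} (w : Node) c → Unique xs →
  ∑ xs (λ x → if does (x ≟N w) then c else 0) ≤ c
∑-indicator w c [] = z≤n
∑-indicator {x ∷ xs} w c (x∉ ∷ xs!) with x ≟N w
... | no _     = ∑-indicator w c xs!
... | yes refl = ≤-reflexive (trans (cong (c +_) (absent x∉)) (+-identityʳ c))
  where
  absent : ∀ {ys} → All (x ≢_) ys → ∑ ys (λ y → if does (y ≟N x) then c else 0) ≡ 0
  absent [] = refl
  absent {y ∷ _} (x≢y ∷ rest) rewrite dec-false (y ≟N x) (x≢y ∘ sym) = absent rest

-- Placements and the potential

Within : ∀ {E : Set} → ℕ → (E → Node) → Set
Within D nd = (∀ e → InTree D (nd e)) × (∀ {e e′} → nd e ≡ nd e′ → e ≡ e′)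

applySwap-Within : ∀ {E : Set} {D w} {nd : E → Node} → ValidSwap D w →
  Within D nd → Within D (applySwap w nd)
applySwap-Within {w = w} {nd} (_ , w∈) (nd∈ , inj) =
  (λ e → transpose-InTree {w = w} w∈ {nd e} (nd∈ e)) , inj ∘ transpose-injective w

applySwaps-Within : ∀ {E : Set} {D ws} {nd : E → Node} → All (ValidSwap D) ws →
  Within D nd → Within D (applySwaps ws nd)
applySwaps-Within []         within = within
applySwaps-Within {ws = w ∷ _} (w∈ ∷ ws∈) within = applySwaps-Within ws∈ (applySwap-Within {w = w} w∈ within)

-- The potential of an element is the excess (truncated at 0) of its height
-- over `2 * ℓ + 1`, where `ℓ` is its level in the offline tree.
excess : ℕ → ℕ → ℕ → ℕ
excess M h j = h ∸ suc (2 * j) * 2 ^ M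

potential : ∀ {E : Set} → ℕ → List E → Rotor → (E → Node) → (E → Node) → ℕ
potential M L rot nd opt = ∑ L λ e → excess M (height M rot (nd e)) (level (opt e))

excess-promote : ∀ M h j → excess M h j ≤ excess M h (suc j) + 2 * 2 ^ M
excess-promote M h j = m≤n+o⇒m∸n≤o h (suc (2 * j) * N) (begin
  h ≤⟨ m≤n+m∸n h (suc (2 * suc j) * N) ⟩
  suc (2 * suc j) * N + excess M h (suc j) ≡⟨ regroup j N (excess M h (suc j)) ⟩
  suc (2 * j) * N + (excess M h (suc j) + 2 * N) ∎)
  where
  open ≤-Reasoning
  N = 2 ^ M
  regroup : ∀ j N x → suc (2 * suc j) * N + x ≡ suc (2 * j) * N + (x + 2 * N)
  regroup = solve-∀

excess-demote : ∀ M h j → excess M h (suc j) ≤ excess M h j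
excess-demote M h j = ∸-monoʳ-≤ h (*-monoˡ-≤ (2 ^ M) (s≤s (*-monoʳ-≤ 2 (n≤1+n j))))

-- A positive excess over `2 * j + 1` forces `2 * j < ℓ`, so that the growth
-- `2 ^ (M ∸ ℓ)` is at most `weight M j`.
excess-growth : ∀ {M h h′ ℓ} j → h′ ≤ h + 2 ^ (M ∸ ℓ) → h′ ≤ suc ℓ * 2 ^ M →
  excess M h′ j ≤ excess M h j + weight M j
excess-growth {M} {h} {h′} {ℓ} j grow h′≤ with 2 * j <? ℓ
... | yes 2j<ℓ = m≤n+o⇒m∸n≤o h′ (suc (2 * j) * 2 ^ M) (begin
  h′
    ≤⟨ grow ⟩
  h + 2 ^ (M ∸ ℓ)
    ≤⟨ +-mono-≤ (m≤n+m∸n h (suc (2 * j) * 2 ^ M)) (^-monoʳ-≤ 2 (∸-monoʳ-≤ M 2j<ℓ)) ⟩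
  suc (2 * j) * 2 ^ M + excess M h j + weight M j
    ≡⟨ +-assoc (suc (2 * j) * 2 ^ M) _ _ ⟩
  suc (2 * j) * 2 ^ M + (excess M h j + weight M j) ∎)
  where open ≤-Reasoning
... | no 2j≮ℓ rewrite m≤n⇒m∸n≡0 (≤-trans h′≤ (*-monoˡ-≤ (2 ^ M) (s≤s (≮⇒≥ 2j≮ℓ)))) = z≤n

-- Only the element moved up in the offline tree can gain: its threshold drops by `2 * 2 ^ M`, while
-- that of its partner rises. By injectivity at most one element sits at the lower node.
potential-swap : ∀ {E : Set} M {L : List E} rot (nd : E → Node) {opt : E → Node} {D} w →
  Unique L → Within D opt → potential M L rot nd (applySwap w opt) ≤ potential M L rot nd opt + 2 * 2 ^ M
potential-swap M rot nd [] L! _ = m≤m+n _ _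
potential-swap M {L} rot nd {opt} (b ∷ p) L! (_ , inj) = begin
  potential M L rot nd (applySwap (b ∷ p) opt)
    ≤⟨ ∑-mono L pointwise ⟩
  ∑ L (λ e → φ e + promoted (opt e))
    ≡⟨ ∑-+ L φ (promoted ∘ opt) ⟩
  potential M L rot nd opt + ∑ L (promoted ∘ opt)
    ≡⟨ cong (potential M L rot nd opt +_) (∑-map opt L promoted) ⟨
  potential M L rot nd opt + ∑ (map opt L) promoted
    ≤⟨ +-monoʳ-≤ (potential M L rot nd opt)
         (∑-indicator (b ∷ p) (2 * 2 ^ M) (Unique.map⁺ inj L!)) ⟩
  potential M L rot nd opt + 2 * 2 ^ M ∎
  where
  open ≤-Reasoning
  φ = λ e → excess M (height M rot (nd e)) (level (opt e))
  promoted : Node → ℕ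
  promoted x = if does (x ≟N (b ∷ p)) then 2 * 2 ^ M else 0
  excess-transpose : ∀ h x →
    excess M h (level (transpose (b ∷ p) x)) ≤ excess M h (level x) + promoted x
  excess-transpose h x with transposeView b p x
  ... | lower rewrite transpose-lower b p | dec-true ((b ∷ p) ≟N (b ∷ p)) refl =
    excess-promote M h (level p)
  ... | upper rewrite transpose-upper b p = ≤-trans (excess-demote M h (level p)) (m≤m+n _ _)
  ... | other ≢w ≢p rewrite transpose-other ≢w ≢p = m≤m+n _ _
  pointwise = λ e → excess-transpose (height M rot (nd e)) (opt e)

potential-swaps : ∀ {E : Set} M {L : List E} rot (nd : E → Node) {opt : E → Node} {D ws} →
  Unique L → All (ValidSwap D) ws → Within D opt →
  potential M L rot nd (applySwaps ws opt) ≤ potential M L rot nd opt + length ws * (2 * 2 ^ M)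
potential-swaps M rot nd L! [] _ = m≤m+n _ _
potential-swaps M {L} rot nd {opt} {ws = w ∷ ws} L! (w∈ ∷ ws∈) within = begin
  potential M L rot nd (applySwaps ws (applySwap w opt))
    ≤⟨ potential-swaps M rot nd L! ws∈ (applySwap-Within {w = w} w∈ within) ⟩
  potential M L rot nd (applySwap w opt) + length ws * (2 * 2 ^ M)
    ≤⟨ +-monoˡ-≤ _ (potential-swap M rot nd w L! within) ⟩
  potential M L rot nd opt + 2 * 2 ^ M + length ws * (2 * 2 ^ M)
    ≡⟨ +-assoc (potential M L rot nd opt) _ _ ⟩
  potential M L rot nd opt + length (w ∷ ws) * (2 * 2 ^ M) ∎
  where open ≤-Reasoning

-- The choice `M = 2 * D + 1` keeps the exponent in `weight M j` from being truncated for every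
-- level `j` of the tree. As the offline nodes are distinct, all growths together stay within
-- `2 ^ M`.
potential-request : ∀ {E : Set} {D} {L : List E} rot {nd opt : E → Node} {e} →
  let M = suc (2 * D) in Unique L → e ∈ L → Within D nd → Within D opt →
  potential M L (flip rot (level (nd e))) (applySwaps (pd rot (nd e)) nd) opt
    + (level (nd e) ∸ suc (2 * level (opt e))) * 2 ^ M
  ≤ potential M L rot nd opt + 2 ^ M
potential-request {E} {D} {L} rot {nd} {opt} {e} L! e∈L (nd∈ , nd-inj) (opt∈ , opt-inj) = begin
  ∑ L φ′ + K                ≤⟨ +-monoʳ-≤ (∑ L φ′) K≤ ⟩
  ∑ L φ′ + ∑ L δ            ≡⟨ ∑-+ L φ′ δ ⟨
  ∑ L (λ x → φ′ x + δ x)    ≤⟨ ∑-mono L pointwise ⟩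
  ∑ L (λ x → φ x + ω x)     ≡⟨ ∑-+ L φ ω ⟩
  ∑ L φ + ∑ L ω             ≤⟨ +-monoʳ-≤ (∑ L φ) ∑ω≤ ⟩
  ∑ L φ + 2 ^ M             ∎
  where
  open ≤-Reasoning
  M = suc (2 * D)
  u = nd e
  k = level (opt e)
  K = (level u ∸ suc (2 * k)) * 2 ^ M
  rot′ = flip rot (level u)
  nd′ = applySwaps (pd rot u) nd
  φ φ′ ω δ : E → ℕ
  φ x  = excess M (height M rot (nd x)) (level (opt x))
  φ′ x = excess M (height M rot′ (nd′ x)) (level (opt x))
  ω x  = weight M (level (opt x))
  -- The loss of the requested element is booked on its own summand, so that the two sums compare
  -- term by term.
  δ x  = if does (nd x ≟N u) then K else 0

  K≤ : K ≤ ∑ L δ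
  K≤ = ≤-trans (≤-reflexive (sym (cong (if_then K else 0) (dec-true (u ≟N u) refl)))) (∑-∈ δ e∈L)

  ∑ω≤ : ∑ L ω ≤ 2 ^ M
  ∑ω≤ = begin
    ∑ L ω                               ≡⟨ ∑-map opt L (weight M ∘ level) ⟨
    ∑ (map opt L) (weight M ∘ level)    ≤⟨ ∑-⊆ _ (Unique.map⁺ opt-inj L!) opt⊆ ⟩
    ∑ (nodesUpTo D) (weight M ∘ level)  ≤⟨ m+n≤o⇒m≤o _ (∑-nodesUpTo-weight D ≤-refl) ⟩
    2 ^ M                               ∎
    where
    opt⊆ : ∀ {v} → v ∈ map opt L → v ∈ nodesUpTo D
    opt⊆ v∈ with ∈-map⁻ opt v∈
    ... | x , _ , refl = ∈-nodesUpTo (opt∈ x)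

  ≤M : ∀ {ℓ} → ℓ ≤ D → ℓ ≤ M
  ≤M ℓ≤D = m≤n⇒m≤1+n (≤-trans ℓ≤D (m≤m+n D _))

  pointwise : ∀ x → φ′ x + δ x ≤ φ x + ω x
  pointwise x rewrite applySwaps-move (pd rot u) nd x with nd x ≟N u
  ... | yes eq with nd-inj eq
  ... | refl
    -- At the root the height is `2 ^ M`, which never exceeds the threshold; the new excess is 0 and
    -- the whole old excess is lost.
    rewrite move-pd-end rot u
          | m≤n⇒m∸n≡0 (*-monoˡ-≤ (2 ^ M) {1} {suc (2 * k)} (s≤s z≤n)) = begin
    K
      ≡⟨ *-distribʳ-∸ (2 ^ M) (level u) (suc (2 * k)) ⟩
    level u * 2 ^ M ∸ suc (2 * k) * 2 ^ M
      ≤⟨ ∸-monoˡ-≤ (suc (2 * k) * 2 ^ M) (m≤m+n (level u * 2 ^ M) _) ⟩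
    excess M (height M rot u) k
      ≤⟨ m≤m+n _ _ ⟩
    excess M (height M rot u) k + ω e ∎
  pointwise x | no x≢u = begin
    excess M (height M rot′ y) (level (opt x)) + 0     ≡⟨ +-identityʳ _ ⟩
    excess M (height M rot′ y) (level (opt x))
      ≤⟨ excess-growth {M} {height M rot (nd x)} {ℓ = level y} (level (opt x))
           (height-pushDown rot u (≤M (nd∈ x)) (≤M (nd∈ e)) (move-pd rot u x≢u))
           (height≤ rot′ y (≤M (move-InTree (pd-valid rot u (nd∈ e)) (nd∈ x)))) ⟩
    φ x + ω x                                          ∎
    where
    y = move (pd rot u) (nd x)

-- Amortization over the request sequence.

-- In units of `N`, the cost `4 * d + 1` is at most `8 * k + 5 + 4 * K`. Four times the potential
-- pays `4 * K` but may grow by 4 per request and by 8 per offline swap, leaving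
-- `8 * k + 9 + 8 * sw` against `12 * (sw + k + 1)`.
amortized : ∀ N d k len rest sw ropt K Φ₀ Φ₁ Φ₂ →
  len ≤ 3 * d → d ≤ suc (2 * k) + K →
  Φ₁ ≤ Φ₀ + sw * (2 * N) → Φ₂ + K * N ≤ Φ₁ + N → N * rest ≤ 12 * (N * ropt) + 4 * Φ₂ →
  N * (suc d + len + rest) ≤ 12 * (N * (sw + suc k + ropt)) + 4 * Φ₀
amortized N d k len rest sw ropt K Φ₀ Φ₁ Φ₂ len≤ d≤ Φ₁≤ Φ₂≤ rest≤ = begin
  N * (suc d + len + rest)
    ≤⟨ *-monoʳ-≤ N (+-monoˡ-≤ rest (+-monoʳ-≤ (suc d) len≤)) ⟩
  N * (suc d + 3 * d + rest)
    ≡⟨ lemma₁ N d rest ⟩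
  N * suc (4 * d) + N * rest
    ≤⟨ +-mono-≤ (*-monoʳ-≤ N (s≤s (*-monoʳ-≤ 4 d≤))) rest≤ ⟩
  N * suc (4 * (suc (2 * k) + K)) + (12 * (N * ropt) + 4 * Φ₂)
    ≡⟨ lemma₂ N k K ropt Φ₂ ⟩
  N * (5 + 8 * k + 12 * ropt) + 4 * (Φ₂ + K * N)
    ≤⟨ +-monoʳ-≤ (N * (5 + 8 * k + 12 * ropt)) (*-monoʳ-≤ 4 (≤-trans Φ₂≤ (+-monoˡ-≤ N Φ₁≤))) ⟩
  N * (5 + 8 * k + 12 * ropt) + 4 * (Φ₀ + sw * (2 * N) + N)
    -- The added term is exactly the slack in that comparison.
    ≤⟨ m≤m+n _ (N * (3 + 4 * k + 4 * sw)) ⟩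
  N * (5 + 8 * k + 12 * ropt) + 4 * (Φ₀ + sw * (2 * N) + N) + N * (3 + 4 * k + 4 * sw)
    ≡⟨ lemma₃ N k ropt Φ₀ sw ⟩
  12 * (N * (sw + suc k + ropt)) + 4 * Φ₀ ∎
  where
  open ≤-Reasoning
  lemma₁ : ∀ N d rest → N * (suc d + 3 * d + rest) ≡ N * suc (4 * d) + N * rest
  lemma₁ = solve-∀
  lemma₂ : ∀ N k K ropt Φ₂ → N * suc (4 * (suc (2 * k) + K)) + (12 * (N * ropt) + 4 * Φ₂) ≡
    N * (5 + 8 * k + 12 * ropt) + 4 * (Φ₂ + K * N)
  lemma₂ = solve-∀
  lemma₃ : ∀ N k ropt Φ₀ sw →
    N * (5 + 8 * k + 12 * ropt) + 4 * (Φ₀ + sw * (2 * N) + N) + N * (3 + 4 * k + 4 * sw) ≡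
    12 * (N * (sw + suc k + ropt)) + 4 * Φ₀
  lemma₃ = solve-∀

-- Both placements and the rotor are arbitrary, so that the potential left by one request can pay
-- for the next.
rpCost≤ : ∀ {E : Set} {D} {L : List E} rot {nd opt : E → Node} →
  let M = suc (2 * D) in Unique L → (∀ e → e ∈ L) → Within D nd → Within D opt →
  ∀ σ S → length S ≡ length σ → All (All (ValidSwap D)) S →
  2 ^ M * rpCost rot nd σ ≤ 12 * (2 ^ M * optCost opt (zip S σ)) + 4 * potential M L rot nd opt
rpCost≤ {D = D} rot L! L∋ nd-in opt-in [] [] _ _
  rewrite *-zeroʳ (2 ^ suc (2 * D)) = z≤n
rpCost≤ {D = D} {L} rot {nd} {opt} L! L∋ nd-in opt-in (e ∷ σ) (sw ∷ S) eq (sw∈ ∷ S∈) =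
  amortized (2 ^ M) (level u) k (length (pd rot u)) (rpCost rot′ nd′ σ) (length sw)
    (optCost opt′ (zip S σ)) (level u ∸ suc (2 * k))
    (potential M L rot nd opt) (potential M L rot nd opt′) (potential M L rot′ nd′ opt′)
    (length-pd rot u) (m≤n+m∸n (level u) (suc (2 * k)))
    -- The offline swaps are charged before the request, which is then compared with `opt′`.
    (potential-swaps M rot nd L! sw∈ opt-in)
    (potential-request rot L! (L∋ e) nd-in opt′-in)
    (rpCost≤ rot′ L! L∋ (applySwaps-Within (pd-valid rot u (proj₁ nd-in e)) nd-in) opt′-in
      σ S (suc-injective eq) S∈)
  where
  M = suc (2 * D)
  u = nd e
  opt′ = applySwaps sw opt
  opt′-in = applySwaps-Within sw∈ opt-in
  k = level (opt′ e)
  rot′ = flip rot (level u)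
  nd′ = applySwaps (pd rot u) nd

-- With equal placements an element at level `j` has scaled height at most `j + 1`, below the
-- threshold `2 * j + 1`.
potential-initial : ∀ {E : Set} {M D} (L : List E) rot (nd : E → Node) → D ≤ M → Within D nd →
  potential M L rot nd nd ≡ 0
potential-initial []      rot nd _   _  = refl
potential-initial {M = M} (e ∷ L) rot nd D≤M within@(nd∈ , _)
  rewrite m≤n⇒m∸n≡0 (≤-trans (height≤ {M} rot (nd e) (≤-trans (nd∈ e) D≤M))
                      (*-monoˡ-≤ (2 ^ M) (s≤s (m≤m+n (level (nd e)) (level (nd e) + 0)))))
  = potential-initial L rot nd D≤M within

-- A placement makes `E` finite with decidable equality, which is pulled back from the nodes; this
-- gives the list over which the potential is summed.
enumeration : ∀ {E : Set} {D} {nd : E → Node} → IsPlacement D nd →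
  ∃ λ L → Unique L × (∀ e → e ∈ L)
enumeration {E} {D} {nd} (nd∈ , inj , onto) =
  deduplicate _≟E_ L , deduplicate-! _≟E_ L , λ e → ∈-deduplicate⁺ _≟E_ (∈L e)
  where
  _≟E_ : DecidableEquality E
  e ≟E e′ = map′ (inj e e′) (cong nd) (nd e ≟N nd e′)
  el : Node → E
  el v with level v ≤? D
  ... | yes v≤D = proj₁ (onto v v≤D)
  -- Outside the tree `el` takes the root element as its default value.
  ... | no _    = proj₁ (onto [] z≤n)
  el-nd : ∀ e → el (nd e) ≡ e
  el-nd e with level (nd e) ≤? D
  ... | yes v≤D = inj _ _ (proj₂ (onto (nd e) v≤D))
  ... | no v≰D  = contradiction (nd∈ e) v≰D
  L = map el (nodesUpTo D)
  ∈L : ∀ e → e ∈ L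
  ∈L e = subst (_∈ L) (el-nd e) (∈-map⁺ el (∈-nodesUpTo {D} {nd e} (nd∈ e)))

theorem1 : (D : ℕ) {E : Set} (nd₀ : E → Node) → IsPlacement D nd₀ →
    (σ : List E) (S : List (List Node)) → length S ≡ length σ →
    All (All (ValidSwap D)) S →
    rpCost initRotor nd₀ σ ≤ 12 * optCost nd₀ (zip S σ)
theorem1 D {E} nd₀ placement@(nd∈ , inj , _) σ S eq S∈ =
  -- The factor `2 ^ M`, which made all heights integral, is cancelled.
  *-cancelˡ-≤ N {{m^n≢0 2 M}} (begin
    N * rpCost initRotor nd₀ σ
      ≤⟨ rpCost≤ initRotor L! L∋ within within σ S eq S∈ ⟩
    12 * (N * opt) + 4 * potential M L initRotor nd₀ nd₀
      ≡⟨ cong (λ Φ → 12 * (N * opt) + 4 * Φ)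
           (potential-initial L initRotor nd₀ (m≤n⇒m≤1+n (m≤m+n D _)) within) ⟩
    12 * (N * opt) + 0
      ≡⟨ rearrange N opt ⟩
    N * (12 * opt) ∎)
  where
  open ≤-Reasoning
  M = suc (2 * D)
  N = 2 ^ M
  opt = optCost nd₀ (zip S σ)
  enum = enumeration placement
  L = proj₁ enum
  L! = proj₁ (proj₂ enum)
  L∋ = proj₂ (proj₂ enum)
  within : Within D nd₀
  within = nd∈ , inj _ _
  rearrange : ∀ N a → 12 * (N * a) + 0 ≡ N * (12 * a)
  rearrange = solve-∀
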